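{- Fix an integer $k\ge 0$. Let $X$ be a finite clique complex such that every strongly connected, pure $(k+1)$-dimensional subcomplex $S\subseteq X$ contains at least one vertex $v$ with $\deg_S(v)\le 2k+1$. Then $X$ is $(k+1)$-collapsible.
   Context: A simplicial complex is a clique complex (flag complex) if it is the maximal simplicial complex supported on its edge set, i.e. every complete subgraph of its 1-skeleton is filled in with a simplex. For a vertex $v$ of a complex $S$, $\deg_S(v)$ is the degree of $v$ in the 1-skeleton of $S$ (the number of edges of $S$ containing $v$). A $d$-dimensional simplicial complex is pure if all of its maximal faces are $d$-dimensional. A pure $d$-dimensional complex is strongly connected if for every pair of its $d$-faces $\sigma,\tau$ there is a sequence of $d$-faces $\sigma=\sigma_0,\sigma_1,\ldots,\sigma_j=\tau$ of it such that $\sigma_i\cap\sigma_{i+1}$ is a $(d-1)$-face for every $i$. Let $\Delta$ be a simplicial complex with (nonempty) faces $\sigma\subsetneq\tau$ such that $\tau$ is a maximal face of $\Delta$ and $\sigma$ is contained in no other maximal face of $\Delta$. Then $\sigma$ is called a free face of $\tau$, and the simplicial collapse of the interval $[\sigma,\tau]$ is the removal from $\Delta$ of all faces $\eta$ with $\sigma\subseteq\eta\subseteq\tau$. A complex is $m$-collapsible if all its faces of dimension at least $m$ can be collapsed, i.e. there is a finite (possibly empty) sequence of simplicial collapses reducing it to a complex of dimension at most $m-1$. -}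

module Defs where

open import Level using (0ℓ)
open import Data.Nat.Base using (ℕ; suc; _≤_)
open import Data.Fin.Base using (Fin)
open import Data.Fin.Properties using (_≟_)
open import Data.Fin.Subset using (Subset; ⊥; ⁅_⁆; _∈_; _⊆_; _⊂_; _∩_; _∪_; ∣_∣; Nonempty)
open import Data.Product.Base using (∃; _×_)
open import Data.Vec.Base using (tabulate)
open import Function.Bundles using (_⇔_)
open import Relation.Binary.Construct.Closure.ReflexiveTransitive using (Star)
open import Relation.Binary.PropositionalEquality using (_≡_; _≢_)
open import Relation.Nullary using (¬_; Dec; does; ¬?; _×-dec_)
open import Relation.Unary using (Pred; Decidable)

-- The empty set counts as a face, of dimension -1.  A point u of Fin n need
-- not be a vertex: the vertices are the u for which ⁅ u ⁆ is a face, so the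
-- subcomplexes of a complex live on the same ground set Fin n.
record Complex (n : ℕ) : Set₁ where
  field
    Face        : Pred (Subset n) 0ℓ
    face?       : Decidable Face
    empty-face  : Face ⊥
    down-closed : ∀ {σ τ} → σ ⊆ τ → Face τ → Face σ

open Complex public

private
  variable
    n : ℕ

Subcomplex : Complex n → Complex n → Set
Subcomplex S X = ∀ σ → Face S σ → Face X σ

IsVertex : Complex n → Fin n → Set
IsVertex X v = Face X ⁅ v ⁆

IsEdge : Complex n → Fin n → Fin n → Set
IsEdge X u v = u ≢ v × Face X (⁅ u ⁆ ∪ ⁅ v ⁆)

edge? : (X : Complex n) (u v : Fin n) → Dec (IsEdge X u v)
edge? X u v = ¬? (u ≟ v) ×-dec face? X (⁅ u ⁆ ∪ ⁅ v ⁆)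

IsCliqueComplex : Complex n → Set
IsCliqueComplex X = ∀ σ →
  (∀ u → u ∈ σ → IsVertex X u) →
  (∀ u v → u ∈ σ → v ∈ σ → u ≢ v → IsEdge X u v) →
  Face X σ

neighbours : Complex n → Fin n → Subset n
neighbours X v = tabulate λ u → does (edge? X v u)

-- Each edge containing v is counted through its other endpoint.
deg : Complex n → Fin n → ℕ
deg X v = ∣ neighbours X v ∣

-- Faces are measured by cardinality: dim σ = ∣ σ ∣ - 1.
FaceOfSize : Complex n → ℕ → Subset n → Set
FaceOfSize X s σ = Face X σ × ∣ σ ∣ ≡ s

FaceOfDim : Complex n → ℕ → Subset n → Set
FaceOfDim X d = FaceOfSize X (suc d)

-- dim X ≤ m - 1
DimBelow : Complex n → ℕ → Set
DimBelow X m = ∀ σ → Face X σ → ∣ σ ∣ ≤ m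

HasDim : Complex n → ℕ → Set
HasDim X d = (∃ λ σ → FaceOfDim X d σ) × DimBelow X (suc d)

IsMaximal : Complex n → Subset n → Set
IsMaximal X τ = Face X τ × (∀ ρ → Face X ρ → τ ⊆ ρ → ρ ≡ τ)

IsPure : Complex n → ℕ → Set
IsPure X d = HasDim X d × (∀ τ → IsMaximal X τ → FaceOfDim X d τ)

-- σ ∩ τ is a (d-1)-face, that is, a face with d elements.
Adjacent : Complex n → ℕ → Subset n → Subset n → Set
Adjacent X d σ τ = FaceOfDim X d σ × FaceOfDim X d τ × FaceOfSize X d (σ ∩ τ)

IsStronglyConnected : Complex n → ℕ → Set
IsStronglyConnected X d =
  ∀ σ τ → FaceOfDim X d σ → FaceOfDim X d τ → Star (Adjacent X d) σ τ

IsFreeFace : Complex n → Subset n → Subset n → Set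
IsFreeFace X σ τ =
  Nonempty σ × σ ⊂ τ × IsMaximal X τ × (∀ ρ → IsMaximal X ρ → σ ⊆ ρ → ρ ≡ τ)

_↘_ : Complex n → Complex n → Set
X ↘ Y = ∃ λ σ → ∃ λ τ →
  IsFreeFace X σ τ × (∀ η → Face Y η ⇔ (Face X η × ¬ (σ ⊆ η × η ⊆ τ)))

IsCollapsible : ℕ → Complex n → Set₁
IsCollapsible m X = ∃ λ Y → Star _↘_ X Y × DimBelow Y m

{-# OPTIONS --safe #-}
module Submission where

-- Let m = k + 1 and call a face big if it has more than m elements.  Two big
-- faces touch if they share at least m elements; the transitive closure of
-- touching splits the big faces into components, and the (m+1)-sets below one
-- component generate a strongly connected pure complex S.  A vertex v with
-- deg_S v ≤ 2k + 1 has a link that lives on at most 2k + 1 vertices and is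
-- flag as far as the component is concerned.  A flag complex on at most 2k + 1
-- vertices can be collapsed below dimension k: it is a simplex, or it has a
-- vertex w with a non-neighbour, and then both the link of w (with k lowered
-- by one) and the deletion of w satisfy the bound again.  Coning with v, all
-- big faces of the component that contain v are collapsed away.  The result
-- need not be flag, but each of its components is still closed in the
-- subcomplex of X induced on the component's own vertices, which is all the
-- argument needs, so it repeats until no big face is left.

open import Data.Bool.Base using (true; false)
open import Data.Bool.Properties using () renaming (_≟_ to _≟ᵇ_)
open import Data.Fin.Base using (Fin; zero; suc)
open import Data.Fin.Properties using (_≟_; any?)
open import Data.Fin.Subset
  using (Subset; inside; outside; ⊥; ⁅_⁆; ∁; _∈_; _∉_; _⊆_; _⊂_; _∩_; _∪_; ∣_∣; Nonempty)
open import Data.Fin.Subset.Properties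
open import Data.List.Base using (List; []; _∷_; map; _++_)
open import Data.List.Membership.Propositional using () renaming (_∈_ to _∈ˡ_)
open import Data.List.Membership.Propositional.Properties using (∈-map⁺; ∈-++⁺ˡ; ∈-++⁺ʳ)
open import Data.List.Relation.Unary.Any using (here; there)
open import Data.Nat.Base using (ℕ; zero; suc; _+_; _*_; _≤_; _<_; z≤n; s≤s)
open import Data.Nat.Induction using (<-wellFounded)
open import Data.Nat.Properties
  using (≤-refl; ≤-reflexive; ≤-trans; <-irrefl; <-≤-trans; ≤-<-trans; n≤1+n; ≤-pred; ≤-antisym;
         ≰⇒>; ≮⇒≥; m<n⇒m<1+n; <⇒≤; m≤m+n; +-suc; +-comm; +-identityʳ; +-monoʳ-≤; _≤?_; _<?_; module ≤-Reasoning)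
  renaming (_≟_ to _≟ℕ_)
open import Data.Nat.Tactic.RingSolver using (solve-∀)
open import Data.Product.Base using (∃; ∃₂; _×_; _,_; proj₁; proj₂)
open import Data.Sum.Base using (_⊎_; inj₁; inj₂; [_,_]′)
open import Data.Vec.Base using ([]; _∷_; here; there)
open import Data.Vec.Properties using (≡-dec; lookup∘tabulate; lookup⇒[]=; []=⇒lookup)
open import Function.Base using (_∘_; id)
open import Function.Bundles using (mk⇔)
open import Induction.WellFounded using (Acc; acc)
open import Relation.Binary.Construct.Closure.ReflexiveTransitive as Star using (Star; ε; _◅_; _◅◅_)
open import Relation.Binary.Core using (Rel)
open import Relation.Binary.Definitions using (DecidableEquality) renaming (Decidable to Decidable₂)
open import Relation.Binary.PropositionalEquality using (_≡_; _≢_; refl; sym; trans; cong; subst)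
open import Relation.Nullary using (¬_; Dec; yes; no; does; contradiction; ¬?; _×-dec_; _⊎-dec_)
open import Relation.Nullary.Decidable using (map′; dec-true; decidable-stable)
open import Relation.Unary using (Pred; Decidable)
open import Level using (0ℓ)
open import Defs

private
  variable
    n d : ℕ
    V : Set
    p q r : Subset n
    u v : Fin n

-- Finite sets

∣p∪⁅x⁆∣≡1+∣p∣ : ∀ {x : Fin n} (p : Subset n) → x ∉ p → ∣ p ∪ ⁅ x ⁆ ∣ ≡ suc ∣ p ∣
∣p∪⁅x⁆∣≡1+∣p∣ {x = zero}  (true  ∷ p) x∉p = contradiction here x∉p
∣p∪⁅x⁆∣≡1+∣p∣ {x = zero}  (false ∷ p) x∉p = cong (suc ∘ ∣_∣) (∪-identityʳ p)
∣p∪⁅x⁆∣≡1+∣p∣ {x = suc x} (true  ∷ p) x∉p = cong suc (∣p∪⁅x⁆∣≡1+∣p∣ p (x∉p ∘ there))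
∣p∪⁅x⁆∣≡1+∣p∣ {x = suc x} (false ∷ p) x∉p = ∣p∪⁅x⁆∣≡1+∣p∣ p (x∉p ∘ there)

p⊆q∧∣q∣≤∣p∣⇒q⊆p : p ⊆ q → ∣ q ∣ ≤ ∣ p ∣ → q ⊆ p
p⊆q∧∣q∣≤∣p∣⇒q⊆p {p = p} p⊆q ∣q∣≤∣p∣ {x} x∈q with x ∈? p
... | yes x∈p = x∈p
... | no  x∉p = contradiction (<-≤-trans (p⊂q⇒∣p∣<∣q∣ (p⊆q , x , x∈q , x∉p)) ∣q∣≤∣p∣) (<-irrefl refl)

∣p∣≤∣p∩q∣∧∣q∣≤∣p∩q∣⇒p≡q : ∣ p ∣ ≤ ∣ p ∩ q ∣ → ∣ q ∣ ≤ ∣ p ∩ q ∣ → p ≡ q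
∣p∣≤∣p∩q∣∧∣q∣≤∣p∩q∣⇒p≡q {p = p} {q = q} ∣p∣≤ ∣q∣≤ =
  ⊆-antisym (p∩q⊆q p q ∘ p⊆q∧∣q∣≤∣p∣⇒q⊆p (p∩q⊆p p q) ∣p∣≤)
            (p∩q⊆p p q ∘ p⊆q∧∣q∣≤∣p∣⇒q⊆p (p∩q⊆q p q) ∣q∣≤)

∣p∣<∣q∣⇒∃x∈q∖p : ∀ (p q : Subset n) → ∣ p ∣ < ∣ q ∣ → ∃ λ x → x ∈ q × x ∉ p
∣p∣<∣q∣⇒∃x∈q∖p p q ∣p∣<∣q∣ with any? (λ x → x ∈? q ×-dec ¬? (x ∈? p))
... | yes x∈q∖p = x∈q∖p
... | no  ∄     = contradiction (<-≤-trans ∣p∣<∣q∣ (p⊆q⇒∣p∣≤∣q∣ q⊆p)) (<-irrefl refl)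
  where
  q⊆p : q ⊆ p
  q⊆p {x} x∈q = decidable-stable (x ∈? p) λ x∉p → ∄ (x , x∈q , x∉p)

interpolate : ∀ (p q : Subset n) s → p ⊆ q → ∣ p ∣ ≤ s → s ≤ ∣ q ∣ →
  ∃ λ r → p ⊆ r × r ⊆ q × ∣ r ∣ ≡ s
interpolate []          []          zero    p⊆q _ _ = [] , id , id , refl
interpolate (true  ∷ p) (false ∷ q) s       p⊆q _ _ with () ← p⊆q here
interpolate (true  ∷ p) (true  ∷ q) (suc s) p⊆q (s≤s ∣p∣≤s) (s≤s s≤∣q∣) =
  let r , p⊆r , r⊆q , ∣r∣≡s = interpolate p q s (drop-∷-⊆ p⊆q) ∣p∣≤s s≤∣q∣
  in  true ∷ r , s⊆s p⊆r , s⊆s r⊆q , cong suc ∣r∣≡s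
interpolate (false ∷ p) (false ∷ q) s       p⊆q ∣p∣≤s s≤∣q∣ =
  let r , p⊆r , r⊆q , ∣r∣≡s = interpolate p q s (drop-∷-⊆ p⊆q) ∣p∣≤s s≤∣q∣
  in  false ∷ r , s⊆s p⊆r , s⊆s r⊆q , ∣r∣≡s
interpolate (false ∷ p) (true  ∷ q) s       p⊆q ∣p∣≤s s≤1+∣q∣ with s ≤? ∣ q ∣
... | no  s≰∣q∣ = true ∷ q , out⊆ (drop-∷-⊆ p⊆q) , id , ≤-antisym (≰⇒> s≰∣q∣) s≤1+∣q∣
... | yes s≤∣q∣ =
  let r , p⊆r , r⊆q , ∣r∣≡s = interpolate p q s (drop-∷-⊆ p⊆q) ∣p∣≤s s≤∣q∣
  in  false ∷ r , s⊆s p⊆r , out⊆ r⊆q , ∣r∣≡s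

subset-of-size : ∀ (q : Subset n) s → s ≤ ∣ q ∣ → ∃ λ r → r ⊆ q × ∣ r ∣ ≡ s
subset-of-size {n = n} q s s≤∣q∣ =
  let r , _ , r⊆q , ∣r∣≡s =
        interpolate ⊥ q s (⊆-min q) (≤-trans (≤-reflexive (∣⊥∣≡0 n)) z≤n) s≤∣q∣
  in  r , r⊆q , ∣r∣≡s

∪-least : p ⊆ r → q ⊆ r → p ∪ q ⊆ r
∪-least {p = p} {q = q} p⊆r q⊆r x∈ = [ p⊆r , q⊆r ]′ (x∈p∪q⁻ p q x∈)

∩-greatest : r ⊆ p → r ⊆ q → r ⊆ p ∩ q
∩-greatest r⊆p r⊆q x∈r = x∈p∩q⁺ (r⊆p x∈r , r⊆q x∈r)

⁅x⁆⊆p : v ∈ p → ⁅ v ⁆ ⊆ p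
⁅x⁆⊆p {v = v} v∈p u∈⁅v⁆ with refl ← x∈⁅y⁆⇒x≡y v u∈⁅v⁆ = v∈p

p∖x⊆p : ∀ (p : Subset n) v → p ∩ ∁ ⁅ v ⁆ ⊆ p
p∖x⊆p p v = p∩q⊆p p (∁ ⁅ v ⁆)

x∉p∖x : ∀ (p : Subset n) v → v ∉ p ∩ ∁ ⁅ v ⁆
x∉p∖x p v v∈ = x∈∁p⇒x∉p (p∩q⊆q p (∁ ⁅ v ⁆) v∈) (x∈⁅x⁆ v)

x∈p∖y : u ∈ p → u ≢ v → u ∈ p ∩ ∁ ⁅ v ⁆
x∈p∖y u∈p u≢v = x∈p∩q⁺ (u∈p , x∉p⇒x∈∁p (x≢y⇒x∉⁅y⁆ u≢v))

p∖x⊂p : v ∈ p → p ∩ ∁ ⁅ v ⁆ ⊂ p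
p∖x⊂p {v = v} {p = p} v∈p = p∖x⊆p p v , v , v∈p , x∉p∖x p v

allSubsets : ∀ n → List (Subset n)
allSubsets zero    = [] ∷ []
allSubsets (suc n) = map (inside ∷_) (allSubsets n) ++ map (outside ∷_) (allSubsets n)

∈-allSubsets : ∀ (p : Subset n) → p ∈ˡ allSubsets n
∈-allSubsets []          = here refl
∈-allSubsets (true  ∷ p) = ∈-++⁺ˡ (∈-map⁺ _ (∈-allSubsets p))
∈-allSubsets (false ∷ p) = ∈-++⁺ʳ (map _ (allSubsets _)) (∈-map⁺ _ (∈-allSubsets p))

-- Counting and reachability

count : {P : Pred V 0ℓ} → Decidable P → List V → ℕ
count P? []       = 0
count P? (x ∷ xs) with P? x
... | yes _ = suc (count P? xs)
... | no  _ = count P? xs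

count-mono-≤ : {P Q : Pred V 0ℓ} (P? : Decidable P) (Q? : Decidable Q) →
  (∀ x → P x → Q x) → ∀ xs → count P? xs ≤ count Q? xs
count-mono-≤ P? Q? P⊆Q []       = z≤n
count-mono-≤ P? Q? P⊆Q (x ∷ xs) with P? x | Q? x
... | yes Px | yes _  = s≤s (count-mono-≤ P? Q? P⊆Q xs)
... | yes Px | no ¬Qx = contradiction (P⊆Q x Px) ¬Qx
... | no  _  | yes _  = ≤-trans (count-mono-≤ P? Q? P⊆Q xs) (n≤1+n _)
... | no  _  | no  _  = count-mono-≤ P? Q? P⊆Q xs

count-mono-< : {P Q : Pred V 0ℓ} (P? : Decidable P) (Q? : Decidable Q) →
  (∀ x → P x → Q x) → ∀ {x xs} → x ∈ˡ xs → Q x → ¬ P x → count P? xs < count Q? xs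
count-mono-< P? Q? P⊆Q {x} {y ∷ ys} (here refl) Qx ¬Px with P? x | Q? x
... | yes Px | _      = contradiction Px ¬Px
... | no  _  | no ¬Qx = contradiction Qx ¬Qx
... | no  _  | yes _  = s≤s (count-mono-≤ P? Q? P⊆Q ys)
count-mono-< P? Q? P⊆Q {x} {y ∷ ys} (there x∈ys) Qx ¬Px with P? y | Q? y
... | yes Py | yes _  = s≤s (count-mono-< P? Q? P⊆Q x∈ys Qx ¬Px)
... | yes Py | no ¬Qy = contradiction (P⊆Q y Py) ¬Qy
... | no  _  | yes _  = m<n⇒m<1+n (count-mono-< P? Q? P⊆Q x∈ys Qx ¬Px)
... | no  _  | no  _  = count-mono-< P? Q? P⊆Q x∈ys Qx ¬Px

-- Via R xs x y: there is an R-path from x to y with all intermediate points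
-- in xs.  The recursion on xs is that of the Floyd–Warshall algorithm.
Via : Rel V 0ℓ → List V → Rel V 0ℓ
Via R []       x y = x ≡ y ⊎ R x y
Via R (z ∷ zs) x y = Via R zs x y ⊎ (Via R zs x z × Via R zs z y)

via? : {R : Rel V 0ℓ} → DecidableEquality V → Decidable₂ R → ∀ xs → Decidable₂ (Via R xs)
via? _≟V_ R? []       x y = (x ≟V y) ⊎-dec R? x y
via? _≟V_ R? (z ∷ zs) x y = via? _≟V_ R? zs x y ⊎-dec (via? _≟V_ R? zs x z ×-dec via? _≟V_ R? zs z y)

via⇒star : {R : Rel V 0ℓ} → ∀ xs {x y} → Via R xs x y → Star R x y
via⇒star []       (inj₁ refl)    = ε
via⇒star []       (inj₂ Rxy)     = Rxy ◅ ε
via⇒star (z ∷ zs) (inj₁ xy)      = via⇒star zs xy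
via⇒star (z ∷ zs) (inj₂ (a , b)) = via⇒star zs a ◅◅ via⇒star zs b

via-base : {R : Rel V 0ℓ} → ∀ xs {x y} → x ≡ y ⊎ R x y → Via R xs x y
via-base []       b = b
via-base (z ∷ zs) b = inj₁ (via-base zs b)

-- If both halves pass through the same `w`, the stretch between the two visits, with `y` on it, is
-- cut out.
via-trans : {R : Rel V 0ℓ} → ∀ {xs x y z} → y ∈ˡ xs → Via R xs x y → Via R xs y z → Via R xs x z
via-trans (here refl) xy yz = inj₂ ([ id , proj₁ ]′ xy , [ id , proj₂ ]′ yz)
via-trans (there y∈) (inj₁ xy)       (inj₁ yz)       = inj₁ (via-trans y∈ xy yz)
via-trans (there y∈) (inj₁ xy)       (inj₂ (yw , wz)) = inj₂ (via-trans y∈ xy yw , wz)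
via-trans (there y∈) (inj₂ (xw , wy)) (inj₁ yz)       = inj₂ (xw , via-trans y∈ wy yz)
via-trans (there y∈) (inj₂ (xw , _)) (inj₂ (_ , wz)) = inj₂ (xw , wz)

star⇒via : {R : Rel V 0ℓ} {xs : List V} → (∀ x → x ∈ˡ xs) → ∀ {x y} → Star R x y → Via R xs x y
star⇒via {xs = xs} total ε       = via-base xs (inj₁ refl)
star⇒via {xs = xs} total (r ◅ s) = via-trans (total _) (via-base xs (inj₂ r)) (star⇒via total s)

star? : {R : Rel V 0ℓ} {xs : List V} → (∀ x → x ∈ˡ xs) →
  DecidableEquality V → Decidable₂ R → Decidable₂ (Star R)
star? {xs = xs} total _≟V_ R? x y =
  map′ (via⇒star xs) (star⇒via total) (via? _≟V_ R? xs x y)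

-- Complexes

edge-of-face : (X : Complex n) → ∀ {σ} → Face X σ → u ∈ σ → v ∈ σ → u ≢ v → IsEdge X u v
edge-of-face X σ∈X u∈σ v∈σ u≢v = u≢v , down-closed X (∪-least (⁅x⁆⊆p u∈σ) (⁅x⁆⊆p v∈σ)) σ∈X

vertex-of-face : (X : Complex n) → ∀ {σ} → Face X σ → u ∈ σ → IsVertex X u
vertex-of-face X σ∈X u∈σ = down-closed X (⁅x⁆⊆p u∈σ) σ∈X

∈-neighbours⁺ : (X : Complex n) → IsEdge X v u → u ∈ neighbours X v
∈-neighbours⁺ {v = v} {u = u} X e = lookup⇒[]= u _ (trans (lookup∘tabulate _ u) (dec-true (edge? X v u) e))

∈-neighbours⁻ : (X : Complex n) → u ∈ neighbours X v → IsEdge X v u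
∈-neighbours⁻ {u = u} {v = v} X u∈ =
  witness (edge? X v u) (trans (sym (lookup∘tabulate _ u)) ([]=⇒lookup u∈))
  where
  witness : ∀ {P : Set} (P? : Dec P) → does P? ≡ true → P
  witness (yes p) _ = p

-- Freeness is phrased with all faces above `σ` instead of the maximal ones. This is the form that
-- down-closure of the remainder uses, and freeness in the sense of maximal faces follows from it.
module _ (Z : Complex n) (σ τ : Subset n) (σ≢∅ : Nonempty σ)
         (σ-free : ∀ ρ → Face Z ρ → σ ⊆ ρ → ρ ⊆ τ) where

  removeInterval : Complex n
  removeInterval .Face η               = Face Z η × ¬ (σ ⊆ η × η ⊆ τ)
  removeInterval .face? η              = face? Z η ×-dec ¬? (σ ⊆? η ×-dec η ⊆? τ)
  removeInterval .empty-face           = empty-face Z , λ (σ⊆⊥ , _) → ∉⊥ (σ⊆⊥ (proj₂ σ≢∅))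
  removeInterval .down-closed η⊆θ (θ∈Z , θ∉) =
    down-closed Z η⊆θ θ∈Z , λ (σ⊆η , _) → θ∉ (η⊆θ ∘ σ⊆η , σ-free _ θ∈Z (η⊆θ ∘ σ⊆η))

  ↘-removeInterval : Face Z τ → σ ⊂ τ → Z ↘ removeInterval
  ↘-removeInterval τ∈Z σ⊂τ =
    σ , τ ,
    (σ≢∅ , σ⊂τ ,
     (τ∈Z , λ ρ ρ∈Z τ⊆ρ → ⊆-antisym (σ-free ρ ρ∈Z (τ⊆ρ ∘ proj₁ σ⊂τ)) τ⊆ρ) ,
     (λ ρ (ρ∈Z , ρ-max) σ⊆ρ → sym (ρ-max τ τ∈Z (σ-free ρ ρ∈Z σ⊆ρ)))) ,
    λ η → mk⇔ id id

Big : ℕ → Complex n → Subset n → Set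
Big m Z σ = Face Z σ × m < ∣ σ ∣

Touch : ℕ → Complex n → Rel (Subset n) 0ℓ
Touch m Z σ τ = Big m Z σ × Big m Z τ × m ≤ ∣ σ ∩ τ ∣

-- Clearing the star of a face

-- Only big faces are tracked. A collapse may also remove small faces, such as `A` itself, but the
-- dimension bound to be reached concerns big faces alone.
record Cleared (m : ℕ) (Q : Pred (Subset n) 0ℓ) (A : Subset n) (Z Z′ : Complex n) : Set₁ where
  field
    steps : Star _↘_ Z Z′
    sub   : Subcomplex Z′ Z
    kept  : ∀ {η} → Big m Z η → ¬ (Q η × A ⊆ η) → Face Z′ η
    gone  : ∀ {η} → Big m Z′ η → ¬ (Q η × A ⊆ η)

module Clearing (X : Complex n) (flag : IsCliqueComplex X) (m : ℕ)
                (Q : Pred (Subset n) 0ℓ) (Q? : Decidable Q) where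

  private
    variable
      Z : Complex n
      A N : Subset n
      w : Fin n

  -- The invariant of the recursion. `filled` is flagness relative to `X`, demanded only over `A`,
  -- inside `A ∪ N` and next to a face of `Q`. By `vertex` and `joined`, whether `A ∪ N` is a face
  -- of `X` depends only on the edges inside `N`.
  record Confined (A N : Subset n) (Z : Complex n) : Set where
    field
      sub      : Subcomplex Z X
      closed   : ∀ {σ τ} → Touch m Z σ τ → Q σ → Q τ
      within   : ∀ {ρ} → Big m Z ρ → Q ρ → A ⊆ ρ → ρ ⊆ A ∪ N
      filled   : ∀ {σ ρ} → Big m Z σ → Q σ → A ⊆ σ →
                 Big m X ρ → A ⊆ ρ → ρ ⊆ A ∪ N → m ≤ ∣ σ ∩ ρ ∣ → Face Z ρ
      vertex   : ∀ {u} → u ∈ A ∪ N → IsVertex X u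
      joined   : ∀ {u v} → u ∈ A → v ∈ A ∪ N → u ≢ v → IsEdge X u v
      disjoint : ∀ {u} → u ∈ A → u ∉ N

  open Confined

  sym-edge : ∀ {u v} → IsEdge X u v → IsEdge X v u
  sym-edge (u≢v , uv∈X) = edge-of-face X uv∈X (q⊆p∪q _ _ (x∈⁅x⁆ _)) (p⊆p∪q _ (x∈⁅x⁆ _)) (u≢v ∘ sym)

  idle : (∀ {ρ} → Big m Z ρ → ¬ (Q ρ × A ⊆ ρ)) → Cleared m Q A Z Z
  idle none = record { steps = ε ; sub = λ _ → id ; kept = λ (η∈Z , _) _ → η∈Z ; gone = none }

  module _ (A N : Subset n) (w : Fin n) (w∈N : w ∈ N) where

    -- Adjacency is read in `X`, which is flag and stays fixed while `Z` is collapsed.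
    linkN : Subset n
    linkN = N ∩ neighbours X w

    link-⊆ : (A ∪ ⁅ w ⁆) ∪ linkN ⊆ A ∪ N
    link-⊆ = ∪-least (∪-least (p⊆p∪q N) (q⊆p∪q A N ∘ ⁅x⁆⊆p w∈N)) (q⊆p∪q A N ∘ p∩q⊆p N _)

    delete-⊆ : A ∪ (N ∩ ∁ ⁅ w ⁆) ⊆ A ∪ N
    delete-⊆ = ∪-least (p⊆p∪q N) (q⊆p∪q A N ∘ p∖x⊆p N w)

    link-⊆-delete : linkN ⊆ N ∩ ∁ ⁅ w ⁆
    link-⊆-delete u∈ =
      let u∈N , u∈lk = x∈p∩q⁻ N _ u∈
      in  x∈p∖y u∈N (proj₁ (∈-neighbours⁻ X u∈lk) ∘ sym)

    confined-link : Confined A N Z → Confined (A ∪ ⁅ w ⁆) linkN Z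
    confined-link {Z = Z} c = record
      { sub      = sub c
      ; closed   = closed c
      ; within   = within′
      ; filled   = λ σ∈Z Qσ A′⊆σ ρ∈X A′⊆ρ ρ⊆ →
                   filled c σ∈Z Qσ (A′⊆σ ∘ p⊆p∪q _) ρ∈X (A′⊆ρ ∘ p⊆p∪q _) (link-⊆ ∘ ρ⊆)
      ; vertex   = vertex c ∘ link-⊆
      ; joined   = joined′
      ; disjoint = disjoint′
      }
      where
      within′ : ∀ {ρ} → Big m Z ρ → Q ρ → A ∪ ⁅ w ⁆ ⊆ ρ → ρ ⊆ (A ∪ ⁅ w ⁆) ∪ linkN
      within′ ρ∈Z Qρ A′⊆ρ {u} u∈ρ with w ≟ u | x∈p∪q⁻ A N (within c ρ∈Z Qρ (A′⊆ρ ∘ p⊆p∪q _) u∈ρ)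
      ... | yes refl | _        = p⊆p∪q _ (q⊆p∪q A _ (x∈⁅x⁆ w))
      ... | no  _    | inj₁ u∈A = p⊆p∪q _ (p⊆p∪q _ u∈A)
      ... | no  w≢u  | inj₂ u∈N = q⊆p∪q (A ∪ ⁅ w ⁆) _ (x∈p∩q⁺ (u∈N , ∈-neighbours⁺ X
        (edge-of-face X (sub c _ (proj₁ ρ∈Z)) (A′⊆ρ (q⊆p∪q A _ (x∈⁅x⁆ w))) u∈ρ w≢u)))

      joined′ : ∀ {u v} → u ∈ A ∪ ⁅ w ⁆ → v ∈ (A ∪ ⁅ w ⁆) ∪ linkN → u ≢ v → IsEdge X u v
      joined′ {u} {v} u∈ v∈ u≢v with x∈p∪q⁻ A ⁅ w ⁆ u∈
      ... | inj₁ u∈A = joined c u∈A (link-⊆ v∈) u≢v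
      ... | inj₂ u∈w with refl ← x∈⁅y⁆⇒x≡y w u∈w | x∈p∪q⁻ (A ∪ ⁅ w ⁆) linkN v∈
      ...   | inj₂ v∈lk = ∈-neighbours⁻ X (p∩q⊆q N _ v∈lk)
      ...   | inj₁ v∈A′ with x∈p∪q⁻ A ⁅ w ⁆ v∈A′
      ...     | inj₁ v∈A = sym-edge (joined c v∈A (q⊆p∪q A N w∈N) (u≢v ∘ sym))
      ...     | inj₂ v∈w = contradiction (sym (x∈⁅y⁆⇒x≡y w v∈w)) u≢v

      disjoint′ : ∀ {u} → u ∈ A ∪ ⁅ w ⁆ → u ∉ linkN
      disjoint′ u∈ u∈lk with x∈p∪q⁻ A ⁅ w ⁆ u∈
      ... | inj₁ u∈A = disjoint c u∈A (p∩q⊆p N _ u∈lk)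
      ... | inj₂ u∈w with refl ← x∈⁅y⁆⇒x≡y w u∈w = x∉p∖x N w (link-⊆-delete u∈lk)

    -- Once the faces over `A ∪ ⁅ w ⁆` are cleared, no big face of `Q` over `A` contains `w`.
    -- Conversely, a face within the smaller ground set avoids `w`, so the clearing has kept it and
    -- `filled` survives.
    confined-delete : ∀ {Z′} → Confined A N Z → Cleared m Q (A ∪ ⁅ w ⁆) Z Z′ →
      Confined A (N ∩ ∁ ⁅ w ⁆) Z′
    confined-delete {Z = Z} {Z′ = Z′} c cl = record
      { sub      = λ η → sub c η ∘ Cleared.sub cl η
      ; closed   = λ (σ∈ , τ∈ , m≤) → closed c (big σ∈ , big τ∈ , m≤)
      ; within   = within′
      ; filled   = λ {σ} {ρ} σ∈ Qσ A⊆σ ρ∈X A⊆ρ ρ⊆ m≤ →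
                   Cleared.kept cl (filled c (big σ∈) Qσ A⊆σ ρ∈X A⊆ρ (delete-⊆ ∘ ρ⊆) m≤ , proj₂ ρ∈X)
                     λ (_ , A′⊆ρ) → w∉ (ρ⊆ (A′⊆ρ (q⊆p∪q A _ (x∈⁅x⁆ w))))
      ; vertex   = vertex c ∘ delete-⊆
      ; joined   = λ u∈A → joined c u∈A ∘ delete-⊆
      ; disjoint = λ u∈A → disjoint c u∈A ∘ p∖x⊆p N w
      }
      where
      big : ∀ {σ} → Big m Z′ σ → Big m Z σ
      big (σ∈ , m<) = Cleared.sub cl _ σ∈ , m<

      w∉ : w ∉ A ∪ (N ∩ ∁ ⁅ w ⁆)
      w∉ w∈ = [ (λ w∈A → disjoint c w∈A w∈N) , x∉p∖x N w ]′ (x∈p∪q⁻ A _ w∈)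

      within′ : ∀ {ρ} → Big m Z′ ρ → Q ρ → A ⊆ ρ → ρ ⊆ A ∪ (N ∩ ∁ ⁅ w ⁆)
      within′ {ρ} ρ∈ Qρ A⊆ρ {u} u∈ρ with x∈p∪q⁻ A N (within c (big ρ∈) Qρ A⊆ρ u∈ρ)
      ... | inj₁ u∈A = p⊆p∪q _ u∈A
      ... | inj₂ u∈N = q⊆p∪q A _ (x∈p∖y u∈N u≢w)
        where
        u≢w : u ≢ w
        u≢w refl = Cleared.gone cl ρ∈ (Qρ , ∪-least A⊆ρ (⁅x⁆⊆p u∈ρ))

  cleared-trans : ∀ {Z₁ Z₂} → Cleared m Q (A ∪ ⁅ w ⁆) Z Z₁ → Cleared m Q A Z₁ Z₂ → Cleared m Q A Z Z₂
  cleared-trans c₁ c₂ = record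
    { steps = C₁.steps ◅◅ C₂.steps
    ; sub   = λ η → C₁.sub η ∘ C₂.sub η
    ; kept  = λ η∈Z ¬Q → C₂.kept (C₁.kept η∈Z (λ (Qη , A′⊆η) → ¬Q (Qη , A′⊆η ∘ p⊆p∪q _)) , proj₂ η∈Z) ¬Q
    ; gone  = C₂.gone
    }
    where
    module C₁ = Cleared c₁
    module C₂ = Cleared c₂

  -- Any two faces over `A` share its `m` elements. Hence one big face of `Q` over `A` puts all big
  -- faces over `A` into `Q` and, by `filled`, makes `A ∪ N` a face of `Z`. Then `A` is free in
  -- `A ∪ N`, and a single collapse suffices.
  clear-facet : ∣ A ∣ ≡ m → Nonempty A → Face X (A ∪ N) → Confined A N Z →
    ∃ (Cleared m Q A Z)
  clear-facet {A = A} {N = N} {Z = Z} ∣A∣≡m A≢∅ K∈X c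
    with anySubset? (λ ρ → (face? Z ρ ×-dec m <? ∣ ρ ∣) ×-dec Q? ρ ×-dec A ⊆? ρ)
  ... | no none = Z , idle λ ρ∈Z q → none (_ , ρ∈Z , q)
  ... | yes (ρ , ρ∈Z , Qρ , A⊆ρ) = removeInterval Z A K A≢∅ free , record
    { steps = ↘-removeInterval Z A K A≢∅ free (proj₁ bigK) A⊂K ◅ ε
    ; sub   = λ _ → proj₁
    ; kept  = λ η∈Z ¬Q → proj₁ η∈Z , λ (A⊆η , _) → ¬Q (Q-up η∈Z A⊆η , A⊆η)
    ; gone  = λ ((η∈Z , η∉) , m<) (Qη , A⊆η) → η∉ (A⊆η , within c (η∈Z , m<) Qη A⊆η)
    }
    where
    K = A ∪ N

    ρ⊆K : ρ ⊆ K
    ρ⊆K = within c ρ∈Z Qρ A⊆ρ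

    m<∣K∣ : m < ∣ K ∣
    m<∣K∣ = <-≤-trans (proj₂ ρ∈Z) (p⊆q⇒∣p∣≤∣q∣ ρ⊆K)

    A⊂K : A ⊂ K
    A⊂K = p⊆p∪q N , ∣p∣<∣q∣⇒∃x∈q∖p A K (≤-<-trans (≤-reflexive ∣A∣≡m) m<∣K∣)

    share-A : ∀ {σ τ} → A ⊆ σ → A ⊆ τ → m ≤ ∣ σ ∩ τ ∣
    share-A A⊆σ A⊆τ = ≤-trans (≤-reflexive (sym ∣A∣≡m)) (p⊆q⇒∣p∣≤∣q∣ (∩-greatest A⊆σ A⊆τ))

    bigK : Big m Z K
    bigK = filled c ρ∈Z Qρ A⊆ρ (K∈X , m<∣K∣) (p⊆p∪q N) id (share-A A⊆ρ (p⊆p∪q N)) , m<∣K∣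

    Q-up : ∀ {η} → Big m Z η → A ⊆ η → Q η
    Q-up η∈Z A⊆η = closed c (ρ∈Z , η∈Z , share-A A⊆ρ A⊆η) Qρ

    free : ∀ η → Face Z η → A ⊆ η → η ⊆ K
    free η η∈Z A⊆η with m <? ∣ η ∣
    ... | yes m< = within c (η∈Z , m<) (Q-up (η∈Z , m<) A⊆η) A⊆η
    -- A face over `A` with at most `m` elements is `A` itself.
    ... | no  m≮ = p⊆p∪q N ∘ p⊆q∧∣q∣≤∣p∣⇒q⊆p A⊆η (≤-trans (≮⇒≥ m≮) (≤-reflexive (sym ∣A∣≡m)))

  -- Flagness of `X` yields a missing edge of `A ∪ N`. It cannot meet `A`, whose elements are joined
  -- to everything.
  non-edge : Confined A N Z → ¬ Face X (A ∪ N) → ∃₂ λ w u → w ∈ N × u ∈ N × w ≢ u × ¬ IsEdge X w u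
  non-edge {A = A} {N = N} c K∉X
    with any? (λ w → any? λ u → w ∈? N ×-dec u ∈? N ×-dec ¬? (w ≟ u) ×-dec ¬? (edge? X w u))
  ... | yes found = found
  ... | no  none  = contradiction (flag (A ∪ N) (λ _ → vertex c) complete) K∉X
    where
    complete : ∀ u v → u ∈ A ∪ N → v ∈ A ∪ N → u ≢ v → IsEdge X u v
    complete u v u∈ v∈ u≢v with x∈p∪q⁻ A N u∈ | x∈p∪q⁻ A N v∈
    ... | inj₁ u∈A | _        = joined c u∈A v∈ u≢v
    ... | inj₂ _   | inj₁ v∈A = sym-edge (joined c v∈A u∈ (u≢v ∘ sym))
    ... | inj₂ u∈N | inj₂ v∈N =
      decidable-stable (edge? X u v) λ ¬e → none (u , v , u∈N , v∈N , u≢v , ¬e)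

  -- N is the ground set of the link of A, f is fuel, and j + suc j is 2j + 1.
  clear : ∀ f j A N Z → ∣ N ∣ ≤ f → ∣ A ∣ + j ≡ m → Nonempty A →
    Face X (A ∪ N) ⊎ ∣ N ∣ ≤ j + suc j → Confined A N Z → ∃ (Cleared m Q A Z)

  -- Faces over `A` that contain `w` are cleared first, through the link of `w`, and the others
  -- afterwards, through the deletion. The link enlarges `A` by one element, so its parameter drops
  -- to `j` and its bound by two; the deletion keeps `suc j`.
  clear-split : ∀ f j A N Z w → w ∈ N → ∣ N ∣ ≤ f → ∣ A ∣ + suc j ≡ m → Nonempty A →
    Face X ((A ∪ ⁅ w ⁆) ∪ (N ∩ neighbours X w)) ⊎ ∣ N ∩ neighbours X w ∣ ≤ j + suc j →
    Face X (A ∪ (N ∩ ∁ ⁅ w ⁆)) ⊎ ∣ N ∩ ∁ ⁅ w ⁆ ∣ ≤ suc j + suc (suc j) →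
    Confined A N Z → ∃ (Cleared m Q A Z)

  clear f j A N Z ∣N∣≤f ∣A∣+j≡m A≢∅ small c with face? X (A ∪ N)
  clear f zero A N Z ∣N∣≤f ∣A∣+j≡m A≢∅ small c | yes K∈X =
    clear-facet (trans (sym (+-identityʳ _)) ∣A∣+j≡m) A≢∅ K∈X c
  clear f (suc j) A N Z ∣N∣≤f ∣A∣+j≡m A≢∅ small c | yes K∈X with nonempty? N
  -- When `A ∪ N` is a simplex any `w` serves, since link and deletion are simplices again.
  ... | yes (w , w∈N) = clear-split f j A N Z w w∈N ∣N∣≤f ∣A∣+j≡m A≢∅
                          (inj₁ (down-closed X (link-⊆ A N w w∈N) K∈X))
                          (inj₁ (down-closed X (delete-⊆ A N w w∈N) K∈X)) c
  -- With `N` empty, a big face of `Q` over `A` would lie in `A`, which has at most `m` elements.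
  ... | no  N≡∅ = Z , idle λ {ρ} ρ∈Z (Qρ , A⊆ρ) → <-irrefl refl (begin-strict
      m         <⟨ proj₂ ρ∈Z ⟩
      ∣ ρ ∣     ≤⟨ p⊆q⇒∣p∣≤∣q∣ (λ u∈ρ → [ id , (λ u∈N → contradiction (_ , u∈N) N≡∅) ]′
                                   (x∈p∪q⁻ A N (within c ρ∈Z Qρ A⊆ρ u∈ρ))) ⟩
      ∣ A ∣     ≤⟨ m≤m+n _ _ ⟩
      ∣ A ∣ + suc j ≡⟨ ∣A∣+j≡m ⟩
      m         ∎)
    where open ≤-Reasoning
  clear f j A N Z ∣N∣≤f ∣A∣+j≡m A≢∅ (inj₁ K∈X) c | no K∉X = contradiction K∈X K∉X
  -- The link of `w` misses both `w` and its non-neighbour `u`, so it has at least two vertices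
  -- fewer than `N`: exactly the drop from `2j + 1` to `2(j - 1) + 1`.
  clear f j A N Z ∣N∣≤f ∣A∣+j≡m A≢∅ (inj₂ ∣N∣≤) c | no K∉X
    with w , u , w∈N , u∈N , w≢u , ¬wu ← non-edge c K∉X
    with p⊂q⇒∣p∣<∣q∣ {p = N ∩ neighbours X w}
           (link-⊆-delete A N w w∈N , u , x∈p∖y u∈N (w≢u ∘ sym) ,
            λ u∈ → ¬wu (∈-neighbours⁻ X (p∩q⊆q N _ u∈)))
       | p⊂q⇒∣p∣<∣q∣ (p∖x⊂p w∈N) | j
  -- For `j = 0` the bound is one vertex, while `w` and `u` are two.
  ... | lk<del | del<N | zero  = contradiction (≤-trans (≤-trans (s≤s lk<del) del<N) ∣N∣≤) λ { (s≤s ()) }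
  ... | lk<del | del<N | suc i = clear-split f i A N Z w w∈N ∣N∣≤f ∣A∣+j≡m A≢∅
    (inj₂ (≤-pred (≤-pred (≤-trans (≤-trans (s≤s lk<del) del<N)
      (≤-trans ∣N∣≤ (≤-reflexive (cong suc (+-suc i (suc i)))))))))
    (inj₂ (≤-trans (<⇒≤ del<N) ∣N∣≤)) c

  clear-split zero j A N Z w w∈N ∣N∣≤f ∣A∣+j≡m A≢∅ link-small delete-small c =
    contradiction (≤-trans (≤-<-trans z≤n (p⊂q⇒∣p∣<∣q∣ (p∖x⊂p w∈N))) ∣N∣≤f) λ ()
  clear-split (suc f) j A N Z w w∈N ∣N∣≤f ∣A∣+j≡m A≢∅ link-small delete-small c =
    let ∣del∣≤f = ≤-pred (<-≤-trans (p⊂q⇒∣p∣<∣q∣ (p∖x⊂p w∈N)) ∣N∣≤f)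
        ∣lk∣≤f  = ≤-trans (p⊆q⇒∣p∣≤∣q∣ (link-⊆-delete A N w w∈N)) ∣del∣≤f
        ∣A′∣+j≡m = trans (cong (_+ j) (∣p∪⁅x⁆∣≡1+∣p∣ A (λ w∈A → disjoint c w∈A w∈N)))
                         (trans (sym (+-suc ∣ A ∣ j)) ∣A∣+j≡m)
        Z₁ , c₁ = clear f j (A ∪ ⁅ w ⁆) (N ∩ neighbours X w) Z ∣lk∣≤f ∣A′∣+j≡m
                    (proj₁ A≢∅ , p⊆p∪q _ (proj₂ A≢∅)) link-small (confined-link A N w w∈N c)
        Z₂ , c₂ = clear f (suc j) A (N ∩ ∁ ⁅ w ⁆) Z₁ ∣del∣≤f ∣A∣+j≡m A≢∅ delete-small
                    (confined-delete A N w w∈N c c₁)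
    in  Z₂ , cleared-trans c₁ c₂

-- Strong components

module _ {Z : Complex n} {m : ℕ} where

  touch-sym : ∀ {σ τ} → Touch m Z σ τ → Touch m Z τ σ
  touch-sym {σ} {τ} (σ∈Z , τ∈Z , m≤) =
    τ∈Z , σ∈Z , ≤-trans m≤ (≤-reflexive (cong ∣_∣ (∩-comm σ τ)))

  touch-⊆ : ∀ {σ τ} → Big m Z σ → m < ∣ τ ∣ → τ ⊆ σ → Touch m Z σ τ
  touch-⊆ σ∈Z m<∣τ∣ τ⊆σ =
    σ∈Z , (down-closed Z τ⊆σ (proj₁ σ∈Z) , m<∣τ∣) ,
    ≤-trans (<⇒≤ m<∣τ∣) (p⊆q⇒∣p∣≤∣q∣ (∩-greatest τ⊆σ id))

  reach-big : ∀ {σ τ} → Star (Touch m Z) σ τ → Big m Z σ → Big m Z τ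
  reach-big ε                 σ∈Z = σ∈Z
  reach-big ((_ , ρ∈Z , _) ◅ s) _ = reach-big s ρ∈Z

touch? : ∀ m (Z : Complex n) → Decidable₂ (Touch m Z)
touch? m Z σ τ = big? σ ×-dec big? τ ×-dec m ≤? ∣ σ ∩ τ ∣
  where
  big? : Decidable (Big m Z)
  big? σ = face? Z σ ×-dec m <? ∣ σ ∣

-- Serves twice: to decide the faces of a component, and to decide the predicate `Q` of the
-- clearing.
reach? : ∀ m (Z : Complex n) → Decidable₂ (Star (Touch m Z))
reach? m Z = star? ∈-allSubsets (≡-dec _≟ᵇ_) (touch? m Z)

module _ (S : Complex n) (d : ℕ) where

  -- Sharing more than `d` of `suc d` elements forces equality, where the empty path will do.
  adjacent : ∀ {α β} → FaceOfDim S d α → FaceOfDim S d β → d ≤ ∣ α ∩ β ∣ → Star (Adjacent S d) α β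
  adjacent {α} {β} α∈S β∈S d≤ with ∣ α ∩ β ∣ ≤? d
  ... | yes ≤d = (α∈S , β∈S , down-closed S (p∩q⊆p α β) (proj₁ α∈S) , ≤-antisym ≤d d≤) ◅ ε
  ... | no  ≰d with refl ← ∣p∣≤∣p∩q∣∧∣q∣≤∣p∩q∣⇒p≡q {p = α} {q = β}
                              (≤-trans (≤-reflexive (proj₂ α∈S)) (≰⇒> ≰d))
                              (≤-trans (≤-reflexive (proj₂ β∈S)) (≰⇒> ≰d)) = ε

  -- Exchange an element of α outside β for one of β outside α.
  facets-connected : ∀ {σ} → (∀ γ → γ ⊆ σ → ∣ γ ∣ ≡ suc d → FaceOfDim S d γ) →
    ∀ f α β → d ≤ f + ∣ α ∩ β ∣ → α ⊆ σ → β ⊆ σ → ∣ α ∣ ≡ suc d → ∣ β ∣ ≡ suc d →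
    Star (Adjacent S d) α β
  facets-connected facet zero α β d≤ α⊆σ β⊆σ ∣α∣≡ ∣β∣≡ =
    adjacent (facet α α⊆σ ∣α∣≡) (facet β β⊆σ ∣β∣≡) d≤
  facets-connected {σ} facet (suc f) α β d≤ α⊆σ β⊆σ ∣α∣≡ ∣β∣≡ with d ≤? ∣ α ∩ β ∣
  ... | yes d≤′ = adjacent (facet α α⊆σ ∣α∣≡) (facet β β⊆σ ∣β∣≡) d≤′
  ... | no  d≰
    with δ , α∩β⊆δ , δ⊆α , ∣δ∣≡d ←
           interpolate (α ∩ β) α d (p∩q⊆p α β) (<⇒≤ (≰⇒> d≰))
             (≤-trans (n≤1+n d) (≤-reflexive (sym ∣α∣≡)))
    with b , b∈β , b∉δ ← ∣p∣<∣q∣⇒∃x∈q∖p δ β (≤-reflexive (trans (cong suc ∣δ∣≡d) (sym ∣β∣≡))) =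
    adjacent (facet α α⊆σ ∣α∣≡) (facet α′ α′⊆σ ∣α′∣≡)
      (≤-trans (≤-reflexive (sym ∣δ∣≡d)) (p⊆q⇒∣p∣≤∣q∣ (∩-greatest δ⊆α (p⊆p∪q _))))
    ◅◅ facets-connected facet f α′ β d≤f+ α′⊆σ β⊆σ ∣α′∣≡ ∣β∣≡
    where
    α′ = δ ∪ ⁅ b ⁆

    α′⊆σ : α′ ⊆ σ
    α′⊆σ = ∪-least (α⊆σ ∘ δ⊆α) (⁅x⁆⊆p (β⊆σ b∈β))

    ∣α′∣≡ : ∣ α′ ∣ ≡ suc d
    ∣α′∣≡ = trans (∣p∪⁅x⁆∣≡1+∣p∣ δ b∉δ) (cong suc ∣δ∣≡d)

    grows : ∣ α ∩ β ∣ < ∣ α′ ∩ β ∣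
    grows = p⊂q⇒∣p∣<∣q∣
      (∩-greatest (p⊆p∪q _ ∘ α∩β⊆δ) (p∩q⊆q α β) ,
       b , x∈p∩q⁺ (q⊆p∪q δ _ (x∈⁅x⁆ b) , b∈β) , b∉δ ∘ α∩β⊆δ)

    d≤f+ : d ≤ f + ∣ α′ ∩ β ∣
    d≤f+ = ≤-trans d≤ (≤-trans (≤-reflexive (sym (+-suc f _))) (+-monoʳ-≤ f grows))

module Component (Y : Complex n) (m : ℕ) (ρ₀ : Subset n) (ρ₀∈Y : Big m Y ρ₀) where

  Reach : Pred (Subset n) 0ℓ
  Reach = Star (Touch m Y) ρ₀

  reached : ∀ {ρ} → Reach ρ → Big m Y ρ
  reached ρ₀ρ = reach-big {Z = Y} ρ₀ρ ρ₀∈Y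

  Facet : Pred (Subset n) 0ℓ
  Facet ρ = Reach ρ × ∣ ρ ∣ ≡ suc m

  facet-⊆ : ∀ {ρ} → Reach ρ → ∀ γ → γ ⊆ ρ → ∣ γ ∣ ≡ suc m → Facet γ
  facet-⊆ ρ₀ρ γ γ⊆ρ ∣γ∣≡ =
    (ρ₀ρ ◅◅ (touch-⊆ {Z = Y} (reached ρ₀ρ) (≤-reflexive (sym ∣γ∣≡)) γ⊆ρ ◅ ε)) , ∣γ∣≡

  -- Reached faces may have more than `suc m` elements; cutting down to those of size `suc m` gives
  -- a pure complex of dimension `m`, to which the degree hypothesis applies.
  component : Complex n
  component .Face η = ∃ λ ρ → Facet ρ × η ⊆ ρ
  component .face? η = anySubset? λ ρ → (reach? m Y ρ₀ ρ ×-dec (∣ ρ ∣ ≟ℕ suc m)) ×-dec η ⊆? ρ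
  component .empty-face =
    let γ , γ⊆ρ₀ , ∣γ∣≡ = subset-of-size ρ₀ (suc m) (proj₂ ρ₀∈Y)
    in  γ , facet-⊆ ε γ γ⊆ρ₀ ∣γ∣≡ , ⊆-min γ
  component .down-closed σ⊆τ (ρ , ρ∈ , τ⊆ρ) = ρ , ρ∈ , τ⊆ρ ∘ σ⊆τ

  component-⊆ : Subcomplex component Y
  component-⊆ η (ρ , (ρ₀ρ , _) , η⊆ρ) = down-closed Y η⊆ρ (proj₁ (reached ρ₀ρ))

  facet-face : ∀ {ρ} → Facet ρ → FaceOfDim component m ρ
  facet-face ρ∈@(_ , ∣ρ∣≡) = (_ , ρ∈ , id) , ∣ρ∣≡

  face-facet : ∀ {σ} → FaceOfDim component m σ → Facet σ
  face-facet ((ρ , (ρ₀ρ , ∣ρ∣≡) , σ⊆ρ) , ∣σ∣≡) = facet-⊆ ρ₀ρ _ σ⊆ρ ∣σ∣≡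

  -- The cut to size `suc m` loses no small faces. In particular, degrees in `component` see every
  -- edge of a reached face.
  small-face : ∀ {ρ η} → Reach ρ → η ⊆ ρ → ∣ η ∣ ≤ suc m → Face component η
  small-face {ρ} {η} ρ₀ρ η⊆ρ ∣η∣≤ =
    let γ , η⊆γ , γ⊆ρ , ∣γ∣≡ = interpolate η ρ (suc m) η⊆ρ ∣η∣≤ (proj₂ (reached ρ₀ρ))
    in  γ , facet-⊆ ρ₀ρ γ γ⊆ρ ∣γ∣≡ , η⊆γ

  component-pure : IsPure component m
  component-pure =
    ((let γ , γ∈ , _ = empty-face component in γ , facet-face γ∈) ,
     λ { σ (ρ , (_ , ∣ρ∣≡) , σ⊆ρ) → ≤-trans (p⊆q⇒∣p∣≤∣q∣ σ⊆ρ) (≤-reflexive ∣ρ∣≡) }) ,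
    λ { τ (τ∈@(ρ , ρ∈ , τ⊆ρ) , τ-max) →
        τ∈ , trans (sym (cong ∣_∣ (τ-max ρ (proj₁ (facet-face ρ∈)) τ⊆ρ))) (proj₂ ρ∈) }

  -- Inside one face the facets are connected by exchanges. Across a touch, `m` common elements `γ`
  -- extend to a facet on either side, and these two facets are adjacent or equal.
  connect : ∀ {σ τ} → Reach σ → Star (Touch m Y) σ τ → ∀ α β → α ⊆ σ → β ⊆ τ →
    ∣ α ∣ ≡ suc m → ∣ β ∣ ≡ suc m → Star (Adjacent component m) α β
  connect {σ} ρ₀σ ε α β α⊆σ β⊆σ =
    facets-connected component m (λ γ γ⊆σ → facet-face ∘ facet-⊆ ρ₀σ γ γ⊆σ) m α β (m≤m+n m _) α⊆σ β⊆σ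
  connect {σ} ρ₀σ (_◅_ {j = σ′} t@(σ∈Y , σ′∈Y , m≤) s) α β α⊆σ β⊆τ ∣α∣≡ ∣β∣≡ =
    let γ , γ⊆ , ∣γ∣≡ = subset-of-size (σ ∩ σ′) m m≤
        ∣γ∣≤ = ≤-trans (≤-reflexive ∣γ∣≡) (n≤1+n m)
        γ₁ , γ⊆γ₁ , γ₁⊆σ  , ∣γ₁∣≡ = interpolate γ σ  (suc m) (p∩q⊆p σ σ′ ∘ γ⊆) ∣γ∣≤ (proj₂ σ∈Y)
        γ₂ , γ⊆γ₂ , γ₂⊆σ′ , ∣γ₂∣≡ = interpolate γ σ′ (suc m) (p∩q⊆q σ σ′ ∘ γ⊆) ∣γ∣≤ (proj₂ σ′∈Y)
        ρ₀σ′ = ρ₀σ ◅◅ (t ◅ ε)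
    in  connect ρ₀σ ε α γ₁ α⊆σ γ₁⊆σ ∣α∣≡ ∣γ₁∣≡
        ◅◅ adjacent component m (facet-face (facet-⊆ ρ₀σ γ₁ γ₁⊆σ ∣γ₁∣≡))
                                (facet-face (facet-⊆ ρ₀σ′ γ₂ γ₂⊆σ′ ∣γ₂∣≡))
             (≤-trans (≤-reflexive (sym ∣γ∣≡)) (p⊆q⇒∣p∣≤∣q∣ (∩-greatest γ⊆γ₁ γ⊆γ₂)))
        ◅◅ connect ρ₀σ′ s γ₂ β γ₂⊆σ′ β⊆τ ∣γ₂∣≡ ∣β∣≡

  component-connected : IsStronglyConnected component m
  component-connected σ τ σ∈ τ∈ =
    let ρ₀σ , ∣σ∣≡ = face-facet σ∈
        ρ₀τ , ∣τ∣≡ = face-facet τ∈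
    in  connect ρ₀σ (Star.reverse (touch-sym {Z = Y}) ρ₀σ ◅◅ ρ₀τ) σ τ id id ∣σ∣≡ ∣τ∣≡

-- Removing vertex stars until no big face is left

module Reduction (X : Complex n) (flag : IsCliqueComplex X) (k : ℕ) where

  private
    m : ℕ
    m = suc k

    size : Complex n → ℕ
    size Y = count (face? Y) (allSubsets n)

  LowDegree : Set₁
  LowDegree = ∀ S → Subcomplex S X → IsPure S m → IsStronglyConnected S m →
    ∃ λ v → IsVertex S v × deg S v ≤ k + suc k

  -- What survives of flagness: every strong component of Y is still closed in
  -- the subcomplex of X induced on the vertex set of that component.
  record Admissible (Y : Complex n) : Set where
    field
      sub  : Subcomplex Y X
      full : ∀ {σ τ} → Big m Y σ → Big m X τ → m ≤ ∣ σ ∩ τ ∣ →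
             (∀ {u} → u ∈ τ → ∃ λ ρ → Star (Touch m Y) σ ρ × u ∈ ρ) → Face Y τ

  admissible-X : Admissible X
  admissible-X = record { sub = λ _ → id ; full = λ _ τ∈X _ _ → proj₁ τ∈X }

  module _ (Y : Complex n) (adm : Admissible Y) (ρ₀ : Subset n) (ρ₀∈Y : Big m Y ρ₀) where

    open Admissible adm
    open Component Y m ρ₀ ρ₀∈Y
    open Clearing X flag m Reach (reach? m Y ρ₀)

    -- Each element of `⁅ v ⁆ ∪ N` lies in a reached face. So a face of `X` inside this set is
    -- covered by the component, and `full` supplies `filled`.
    confined-star : ∀ v → IsVertex component v → Confined ⁅ v ⁆ (neighbours component v) Y
    confined-star v v∈S@(ρᵥ , ρᵥ∈ , v⊆ρᵥ) = record
      { sub      = sub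
      ; closed   = λ t ρ₀σ → ρ₀σ ◅◅ (t ◅ ε)
      ; within   = within′
      ; filled   = λ {σ} {ρ} σ∈Y ρ₀σ _ ρ∈X _ ρ⊆ m≤ → full σ∈Y ρ∈X m≤ λ u∈ρ →
                   let θ , ρ₀θ , u∈θ = covered (ρ⊆ u∈ρ)
                   in  θ , Star.reverse (touch-sym {Z = Y}) ρ₀σ ◅◅ ρ₀θ , u∈θ
      ; vertex   = λ u∈ → let θ , ρ₀θ , u∈θ = covered u∈
                          in  vertex-of-face X (sub θ (proj₁ (reached ρ₀θ))) u∈θ
      ; joined   = joined′
      ; disjoint = λ {u} u∈v u∈N → proj₁ (∈-neighbours⁻ component u∈N) (sym (x∈⁅y⁆⇒x≡y v u∈v))
      }
      where
      N = neighbours component v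

      covered : ∀ {u} → u ∈ ⁅ v ⁆ ∪ N → ∃ λ θ → Reach θ × u ∈ θ
      covered u∈ with x∈p∪q⁻ ⁅ v ⁆ N u∈
      ... | inj₁ u∈v = ρᵥ , proj₁ ρᵥ∈ , v⊆ρᵥ u∈v
      ... | inj₂ u∈N = let _ , θ , θ∈ , vu⊆θ = ∈-neighbours⁻ component u∈N
                       in  θ , proj₁ θ∈ , vu⊆θ (q⊆p∪q ⁅ v ⁆ _ (x∈⁅x⁆ _))

      joined′ : ∀ {u w} → u ∈ ⁅ v ⁆ → w ∈ ⁅ v ⁆ ∪ N → u ≢ w → IsEdge X u w
      joined′ u∈v w∈ u≢w with refl ← x∈⁅y⁆⇒x≡y v u∈v | x∈p∪q⁻ ⁅ v ⁆ N w∈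
      ... | inj₁ w∈v = contradiction (sym (x∈⁅y⁆⇒x≡y v w∈v)) u≢w
      ... | inj₂ w∈N = u≢w , sub _ (component-⊆ _ (proj₂ (∈-neighbours⁻ component w∈N)))

      within′ : ∀ {ρ} → Big m Y ρ → Reach ρ → ⁅ v ⁆ ⊆ ρ → ρ ⊆ ⁅ v ⁆ ∪ N
      within′ ρ∈Y ρ₀ρ v⊆ρ {u} u∈ρ with u ≟ v
      ... | yes refl = p⊆p∪q N (x∈⁅x⁆ u)
      ... | no  u≢v  = q⊆p∪q ⁅ v ⁆ N (∈-neighbours⁺ component
        (u≢v ∘ sym , small-face ρ₀ρ (∪-least v⊆ρ (⁅x⁆⊆p u∈ρ)) (begin
          ∣ ⁅ v ⁆ ∪ ⁅ u ⁆ ∣ ≡⟨ ∣p∪⁅x⁆∣≡1+∣p∣ ⁅ v ⁆ (x≢y⇒x∉⁅y⁆ u≢v) ⟩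
          suc ∣ ⁅ v ⁆ ∣     ≡⟨ cong suc (∣⁅x⁆∣≡1 v) ⟩
          -- An edge fits into a facet because `m` is `suc k`, hence at least 1.
          2                 ≤⟨ s≤s (s≤s z≤n) ⟩
          suc m             ∎)))
        where open ≤-Reasoning

    -- Starting from the single vertex `v`, the equation `1 + k = m` fixes `j` as `k`, and the size
    -- bound for the link becomes the degree bound.
    clear-star : ∀ v → IsVertex component v → deg component v ≤ k + suc k → ∃ (Cleared m Reach ⁅ v ⁆ Y)
    clear-star v v∈S deg≤ =
      clear _ k ⁅ v ⁆ (neighbours component v) Y ≤-refl (cong (_+ k) (∣⁅x⁆∣≡1 v)) (v , x∈⁅x⁆ v)
        (inj₂ deg≤) (confined-star v v∈S)

    -- A cover of `τ` in `Y′` is also one in `Y`, so `τ` is a face of `Y`. Had it been cleared, `v`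
    -- would lie in `τ` and hence in some `ρ` of the cover; through `τ` and `σ` this `ρ` is reached
    -- from `ρ₀`, so it should be gone as well.
    admissible-cleared : ∀ {v Y′} → Cleared m Reach ⁅ v ⁆ Y Y′ → Admissible Y′
    admissible-cleared {v} {Y′} cl = record
      { sub  = λ η → sub η ∘ C.sub η
      ; full = full′
      }
      where
      module C = Cleared cl

      big : ∀ {σ} → Big m Y′ σ → Big m Y σ
      big (σ∈ , m<) = C.sub _ σ∈ , m<

      touch : ∀ {σ τ} → Touch m Y′ σ τ → Touch m Y σ τ
      touch (σ∈ , τ∈ , m≤) = big σ∈ , big τ∈ , m≤

      full′ : ∀ {σ τ} → Big m Y′ σ → Big m X τ → m ≤ ∣ σ ∩ τ ∣ →
        (∀ {u} → u ∈ τ → ∃ λ ρ → Star (Touch m Y′) σ ρ × u ∈ ρ) → Face Y′ τ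
      full′ {σ} {τ} σ∈Y′ τ∈X m≤ cover = C.kept τ∈Y not-cleared
        where
        τ∈Y : Big m Y τ
        τ∈Y = full (big σ∈Y′) τ∈X m≤
                (λ u∈τ → let ρ , s , u∈ρ = cover u∈τ in ρ , Star.map touch s , u∈ρ) , proj₂ τ∈X

        not-cleared : ¬ (Reach τ × ⁅ v ⁆ ⊆ τ)
        not-cleared (ρ₀τ , v⊆τ) =
          let ρ , s , v∈ρ = cover (v⊆τ (x∈⁅x⁆ v))
          in  C.gone (reach-big {Z = Y′} s σ∈Y′)
                (ρ₀τ ◅◅ (touch-sym {Z = Y} (big σ∈Y′ , τ∈Y , m≤) ◅ Star.map touch s) , ⁅x⁆⊆p v∈ρ)

    shrink : LowDegree → ∃ λ Y′ → Star _↘_ Y Y′ × Admissible Y′ × size Y′ < size Y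
    shrink low-degree =
      let v , v∈S@(ρ , (ρ₀ρ , _) , v⊆ρ) , deg≤ =
            low-degree component (λ η → sub η ∘ component-⊆ η) component-pure component-connected
          Y′ , cl = clear-star v v∈S deg≤
          ρ∈Y     = reached ρ₀ρ
      in  Y′ , Cleared.steps cl , admissible-cleared cl ,
          -- The facet `ρ` that witnesses `v` as a vertex of the component is big and contains `v`,
          -- so it has disappeared.
          count-mono-< (face? Y′) (face? Y) (Cleared.sub cl) (∈-allSubsets ρ) (proj₁ ρ∈Y)
            λ ρ∈Y′ → Cleared.gone cl (ρ∈Y′ , proj₂ ρ∈Y) (ρ₀ρ , v⊆ρ)

  reduce : LowDegree → ∀ Y → Admissible Y → Acc _<_ (size Y) → IsCollapsible m Y
  reduce low-degree Y adm (acc smaller) with anySubset? (λ ρ → face? Y ρ ×-dec m <? ∣ ρ ∣)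
  ... | no  none = Y , ε , λ σ σ∈Y → ≮⇒≥ λ m< → none (σ , σ∈Y , m<)
  ... | yes (ρ₀ , ρ₀∈Y) =
    let Y′ , s , adm′ , fewer = shrink Y adm ρ₀ ρ₀∈Y low-degree
        Z , s′ , dim≤ = reduce low-degree Y′ adm′ (smaller fewer)
    in  Z , s ◅◅ s′ , dim≤

theorem3p1 : ∀ (k n : ℕ) (X : Complex n) →
    IsCliqueComplex X →
    (∀ (S : Complex n) → Subcomplex S X →
    IsPure S (k + 1) → IsStronglyConnected S (k + 1) →
    ∃ λ v → IsVertex S v × deg S v ≤ 2 * k + 1) →
    IsCollapsible (k + 1) X
theorem3p1 k n X flag low-degree =
  subst (λ m → IsCollapsible m X) 1+k≡k+1
    (reduce low-degree′ X admissible-X (<-wellFounded _))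
  where
  open Reduction X flag k

  1+k≡k+1 : suc k ≡ k + 1
  1+k≡k+1 = +-comm 1 k

  2k+1≡k+[1+k] : ∀ k → 2 * k + 1 ≡ k + suc k
  2k+1≡k+[1+k] = solve-∀

  low-degree′ : LowDegree
  low-degree′ S S⊆X pure connected =
    let v , v∈S , deg≤ = low-degree S S⊆X (subst (IsPure S) 1+k≡k+1 pure)
                           (subst (IsStronglyConnected S) 1+k≡k+1 connected)
    in  v , v∈S , ≤-trans deg≤ (≤-reflexive (2k+1≡k+[1+k] k))
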